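{- Let $C_n^{(3)}(t)=a(2n+2,2,t)$ for $n\ge 0$, where the polynomials $a(n,j,t)$ are as defined in the context. Then for all integers $n\ge 0$ $$\det\bigl(C_{i+j}^{(3)}(t)\bigr)_{i,j=0}^{n-1}=t^{\binom n2}\sum_{k=0}^{\lfloor n/2\rfloor}(-1)^k\binom{n-k}{k}t^{ -k}.$$
   Context: The polynomials $a(n,j,t)$ in the indeterminate $t$ ($n\ge 0$, $j\in\mathbb Z$) are defined by $a(0,j,t)=1$ if $j=0$ and $0$ otherwise, $a(n,j,t)=0$ for $j<0$, and, for $n\ge 1$ and $k\ge 0$, $$a(n,2k,t)=a(n-1,2k-1,t)+a(n-1,2k+1,t),$$ $$a(n,2k+1,t)=a(n-1,2k,t)+t\,a(n-1,2k+2,t).$$ The first terms of $C_n^{(3)}(t)$ are $1,\ 2+t,\ 3+5t+t^2,\ 4+14t+9t^2+t^3,\dots$. The identity is understood in Laurent polynomials in $t$ (the right-hand side is in fact a polynomial). The determinant of the empty ($0\times 0$) matrix is $1$. -}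

module Defs where

open import Algebra.Bundles.Raw using (RawRing)
import Algebra.Definitions.RawSemiring as RawSemiringDefs
open import Data.Fin.Base using (Fin; zero; suc; toℕ; punchIn)
open import Data.Integer.Base as ℤ using (ℤ; +_; -[1+_]; 0ℤ; 1ℤ)
open import Data.Integer.Properties using (_≟_)
open import Data.Bool.Base using (if_then_else_)
open import Data.List.Base using (List; []; _∷_; _++_; map; cartesianProductWith)
open import Data.Nat.Base as ℕ using (ℕ; zero; suc; parity)
open import Data.Parity.Base using (Parity; 0ℙ; 1ℙ)
open import Data.Product.Base using (_×_; _,_)
open import Level using (0ℓ)
open import Relation.Binary.PropositionalEquality.Core using (_≡_)
open import Relation.Nullary.Decidable.Core using (does)

-- A Laurent polynomial over ℤ is a finite formal sum of terms c·tᵉ, stored as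
-- pairs (c , e).  The list is not required to be normalised (exponents may
-- repeat, coefficients may vanish): equality is equality of all coefficients.

Laurent : Set
Laurent = List (ℤ × ℤ)

coeff : Laurent → ℤ → ℤ
coeff []            d = 0ℤ
coeff ((c , e) ∷ p) d = (if does (e ≟ d) then c else 0ℤ) ℤ.+ coeff p d

ℤ[t,t⁻¹] : RawRing 0ℓ 0ℓ
ℤ[t,t⁻¹] = record
  { Carrier = Laurent
  ; _≈_     = λ p q → ∀ d → coeff p d ≡ coeff q d
  ; _+_     = _++_
  ; _*_     = cartesianProductWith (λ (c , e) (c′ , e′) → c ℤ.* c′ , e ℤ.+ e′)
  ; -_      = map (λ (c , e) → ℤ.- c , e)
  ; 0#      = []
  ; 1#      = (1ℤ , 0ℤ) ∷ []
  }

const : ℤ → Laurent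
const c = (c , 0ℤ) ∷ []

t^_ : ℤ → Laurent
t^ e = (1ℤ , e) ∷ []

infix 9 t^_

module _ {c ℓ} (R : RawRing c ℓ) where
  open RawRing R
  open RawSemiringDefs rawSemiring using (_^_; sum)

  -- Laplace expansion along the first row.
  det : ∀ {n} → (Fin n → Fin n → Carrier) → Carrier
  det {zero}  M = 1#
  det {suc n} M =
    sum λ j → (- 1#) ^ toℕ j * (M zero j * det (λ i k → M (suc i) (punchIn j k)))

  module _ (t : Carrier) where

    weighted : Parity → Carrier → Carrier
    weighted 0ℙ x = x
    weighted 1ℙ x = t * x

    -- With m = 2k the neighbours m - 1, m + 1 are 2k - 1, 2k + 1; with
    -- m = 2k + 1 they are 2k, 2k + 2, and the second one carries the factor t.
    a : ℕ → ℤ → Carrier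
    a _       -[1+ _ ]  = 0#
    a zero    (+ zero)  = 1#
    a zero    (+ suc _) = 0#
    a (suc n) (+ m)     = a n (+ m ℤ.- 1ℤ) + weighted (parity m) (a n (+ m ℤ.+ 1ℤ))

-- ℤ[t] is regarded as the subring of ℤ[t,t⁻¹] without negative exponents.
C⁽³⁾ : ℕ → Laurent
C⁽³⁾ n = a ℤ[t,t⁻¹] (t^ 1ℤ) (2 ℕ.* n ℕ.+ 2) (+ 2)

module LaurentOps where
  open RawRing ℤ[t,t⁻¹] public using (_≈_; _+_; _*_; -_; 0#; 1#)
  open RawSemiringDefs (RawRing.rawSemiring ℤ[t,t⁻¹]) public using (_^_; sum)

{-# OPTIONS --safe #-}
module Submission where

-- Consecutive rows of the array a(2n+1, 2k+1) are related by the Jacobi operator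
-- (J f)(k) = f(k+1) + (1+t) f(k) + t f(k-1), and C⁽³⁾ n is the corner entry of Jⁿ T, where T is
-- the tridiagonal matrix with entries t^min(k,l).  As J T is symmetric, the Hankel matrix equals A T Aᵀ with A
-- lower unitriangular, so its determinant is that of the truncation of T.  Expanding the latter gives
-- dₙ₊₂ = tⁿ⁺¹ dₙ₊₁ - t²ⁿ dₙ, which Pascal's rule shows to be the recurrence of the right-hand side.

open import Defs
open import Algebra.Bundles using (CommutativeRing; Semiring)
import Algebra.Definitions.RawSemiring as RawSemiringDefs
import Algebra.Properties.AbelianGroup as AbelianGroupProperties
import Algebra.Properties.CommutativeSemigroup as CommutativeSemigroupProperties
import Algebra.Properties.Ring as RingProperties
import Algebra.Properties.Semiring.Exp as SemiringExp
import Algebra.Properties.Semiring.Sum as SemiringSum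
import Algebra.Solver.Ring.NaturalCoefficients.Default as SemiringSolver
open import Data.Bool.Base using (if_then_else_; true; false)
open import Data.Bool.Properties using (if-float; if-eta)
open import Data.Fin.Base using (Fin; zero; suc; toℕ; punchIn)
import Data.Fin.Properties as Fin
open import Data.Integer.Base as ℤ using (ℤ; +_; 0ℤ; 1ℤ; -1ℤ)
import Data.Integer.Properties as ℤ
open import Data.List.Base using ([]; _∷_; _++_; map)
import Data.List.Properties as List
open import Data.Nat.Base as ℕ using (ℕ; zero; suc; parity; _∸_; ⌊_/2⌋; ⌈_/2⌉)
open import Data.Nat.Combinatorics
  using (_C_; nC1≡n; nCk+nC[k+1]≡[n+1]C[k+1]; k>n⇒nCk≡0)
import Data.Nat.Properties as ℕ
open import Data.Parity.Base using (0ℙ; 1ℙ)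
open import Data.Product.Base using (_×_; _,_)
open import Data.Sum.Base as Sum using (_⊎_; inj₁; inj₂)
open import Function.Base using (_∘_; flip)
open import Function.Bundles using (mk⇔)
open import Level using (0ℓ)
open import Relation.Binary.PropositionalEquality as ≡ using (_≡_)
import Relation.Binary.Reasoning.Setoid as SetoidReasoning
open import Relation.Nullary.Decidable using (does; yes; no; does-⇔)

-- Laurent polynomials over ℤ as a commutative ring.

module LaurentRing where
  open LaurentOps
  open ≡
  open ≡-Reasoning
  open AbelianGroupProperties ℤ.+-0-abelianGroup using (xyx⁻¹≈y)
  open CommutativeSemigroupProperties ℤ.+-commutativeSemigroup using (x∙yz≈y∙xz)

  infixr 7 _·_
  _·_ : ℤ × ℤ → ℤ × ℤ → ℤ × ℤ
  (c , e) · (c′ , e′) = c ℤ.* c′ , e ℤ.+ e′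

  ·-assoc : ∀ x y z → (x · y) · z ≡ x · (y · z)
  ·-assoc (c , e) (c′ , e′) (c″ , e″) = cong₂ _,_ (ℤ.*-assoc c c′ c″) (ℤ.+-assoc e e′ e″)

  ·-comm : ∀ x y → x · y ≡ y · x
  ·-comm (c , e) (c′ , e′) = cong₂ _,_ (ℤ.*-comm c c′) (ℤ.+-comm e e′)

  coeff₁ : ℤ × ℤ → ℤ → ℤ
  coeff₁ (c , e) d = if does (e ℤ.≟ d) then c else 0ℤ

  coeff-++ : ∀ p q d → coeff (p ++ q) d ≡ coeff p d ℤ.+ coeff q d
  coeff-++ []      q d = sym (ℤ.+-identityˡ _)
  coeff-++ (x ∷ p) q d =
    trans (cong (λ z → coeff₁ x d ℤ.+ z) (coeff-++ p q d))
          (sym (ℤ.+-assoc (coeff₁ x d) (coeff p d) (coeff q d)))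

  coeff-neg : ∀ p d → coeff (- p) d ≡ ℤ.- coeff p d
  coeff-neg []            d = refl
  coeff-neg ((c , e) ∷ p) d = trans
    (cong₂ ℤ._+_ (sym (if-float (λ z → ℤ.- z) (does (e ℤ.≟ d)))) (coeff-neg p d))
    (sym (ℤ.neg-distrib-+ (coeff₁ (c , e) d) (coeff p d)))

  -- Multiplication by a monomial shifts and scales the coefficient function. Hence it respects
  -- `_≈_`, which compares coefficients and not lists; `*-congˡ` rests on this.
  coeff-map-· : ∀ c e p d → coeff (map ((c , e) ·_) p) d ≡ c ℤ.* coeff p (d ℤ.- e)
  coeff-map-· c e []              d = sym (ℤ.*-zeroʳ c)
  coeff-map-· c e ((c′ , e′) ∷ p) d = begin
    (if does (e ℤ.+ e′ ℤ.≟ d) then c ℤ.* c′ else 0ℤ) ℤ.+ coeff (map ((c , e) ·_) p) d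
      -- The default 0 becomes c * 0, so that c can be pulled out of the conditional; the two tests
      -- agree by `same-test`.
      ≡⟨ cong₂ ℤ._+_ (cong₂ (λ b z → if b then c ℤ.* c′ else z) same-test (sym (ℤ.*-zeroʳ c)))
                     (coeff-map-· c e p d) ⟩
    (if does (e′ ℤ.≟ d ℤ.- e) then c ℤ.* c′ else c ℤ.* 0ℤ) ℤ.+ c ℤ.* coeff p (d ℤ.- e)
      ≡⟨ cong (λ z → z ℤ.+ _) (if-float (c ℤ.*_) (does (e′ ℤ.≟ d ℤ.- e))) ⟨
    c ℤ.* (if does (e′ ℤ.≟ d ℤ.- e) then c′ else 0ℤ) ℤ.+ c ℤ.* coeff p (d ℤ.- e)
      ≡⟨ ℤ.*-distribˡ-+ c _ (coeff p (d ℤ.- e)) ⟨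
    c ℤ.* coeff ((c′ , e′) ∷ p) (d ℤ.- e) ∎
    where
    to : e ℤ.+ e′ ≡ d → e′ ≡ d ℤ.- e
    to refl = sym (xyx⁻¹≈y e e′)

    from : e′ ≡ d ℤ.- e → e ℤ.+ e′ ≡ d
    from refl = trans (sym (ℤ.+-assoc e d (ℤ.- e))) (xyx⁻¹≈y e d)

    same-test = does-⇔ (mk⇔ to from) (e ℤ.+ e′ ℤ.≟ d) (e′ ℤ.≟ d ℤ.- e)

  ++-cong : ∀ {p p′ q q′} → p ≈ p′ → q ≈ q′ → p ++ q ≈ p′ ++ q′
  ++-cong {p} {p′} {q} {q′} p≈p′ q≈q′ d =
    trans (coeff-++ p q d) (trans (cong₂ ℤ._+_ (p≈p′ d) (q≈q′ d)) (sym (coeff-++ p′ q′ d)))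

  ++-comm : ∀ p q → p ++ q ≈ q ++ p
  ++-comm p q d =
    trans (coeff-++ p q d) (trans (ℤ.+-comm (coeff p d) (coeff q d)) (sym (coeff-++ q p d)))

  neg-cong : ∀ {p q} → p ≈ q → - p ≈ - q
  neg-cong {p} {q} p≈q d =
    trans (coeff-neg p d) (trans (cong (λ z → ℤ.- z) (p≈q d)) (sym (coeff-neg q d)))

  ++-inverseʳ : ∀ p → p ++ (- p) ≈ []
  ++-inverseʳ p d = trans (coeff-++ p (- p) d)
    (trans (cong (λ z → coeff p d ℤ.+ z) (coeff-neg p d)) (ℤ.+-inverseʳ (coeff p d)))

  *-congˡ : ∀ p {q q′} → q ≈ q′ → p * q ≈ p * q′
  *-congˡ []            q≈q′ = λ _ → refl
  *-congˡ ((c , e) ∷ p) {q} {q′} q≈q′ = ++-cong {map ((c , e) ·_) q} {map ((c , e) ·_) q′}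
    (λ d → trans (coeff-map-· c e q d)
             (trans (cong (c ℤ.*_) (q≈q′ (d ℤ.- e))) (sym (coeff-map-· c e q′ d))))
    (*-congˡ p q≈q′)

  -- The list product recurses on its left factor. This is the matching recursion on the right
  -- factor, valid only up to `_≈_` because terms are reordered; it yields commutativity.
  *-∷ : ∀ p x q → p * (x ∷ q) ≈ map (x ·_) p ++ p * q
  *-∷ []      x         q d = refl
  *-∷ (y ∷ p) x         q d = begin
    coeff₁ (y · x) d ℤ.+ coeff (map (y ·_) q ++ p * (x ∷ q)) d
      ≡⟨ cong₂ (λ z i → coeff₁ z d ℤ.+ i) (·-comm y x) (coeff-++ (map (y ·_) q) (p * (x ∷ q)) d) ⟩
    xy ℤ.+ (yq ℤ.+ coeff (p * (x ∷ q)) d)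
      ≡⟨ cong (λ z → xy ℤ.+ (yq ℤ.+ z)) (trans (*-∷ p x q d) (coeff-++ (map (x ·_) p) (p * q) d)) ⟩
    xy ℤ.+ (yq ℤ.+ (xp ℤ.+ coeff (p * q) d))
      ≡⟨ cong (λ z → xy ℤ.+ z) (x∙yz≈y∙xz yq xp (coeff (p * q) d)) ⟩
    xy ℤ.+ (xp ℤ.+ (yq ℤ.+ coeff (p * q) d))
      ≡⟨ cong (λ z → xy ℤ.+ (xp ℤ.+ z)) (coeff-++ (map (y ·_) q) (p * q) d) ⟨
    xy ℤ.+ (xp ℤ.+ coeff ((y ∷ p) * q) d)
      ≡⟨ cong (λ z → xy ℤ.+ z) (coeff-++ (map (x ·_) p) ((y ∷ p) * q) d) ⟨
    coeff (map (x ·_) (y ∷ p) ++ (y ∷ p) * q) d ∎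
    where
    xy = coeff₁ (x · y) d
    xp = coeff (map (x ·_) p) d
    yq = coeff (map (y ·_) q) d

  *-comm : ∀ p q → p * q ≈ q * p
  *-comm []      q d = cong (λ r → coeff r d) (sym (List.cartesianProductWith-zeroʳ _·_ q))
  *-comm (x ∷ p) q d = trans
    (++-cong {map (x ·_) q} {map (x ·_) q} (λ _ → refl) (*-comm p q) d)
    (sym (*-∷ q x p d))

  *-cong : ∀ {p p′ q q′} → p ≈ p′ → q ≈ q′ → p * q ≈ p′ * q′
  *-cong {p} {p′} {q} {q′} p≈p′ q≈q′ d = begin
    coeff (p * q) d   ≡⟨ *-congˡ p q≈q′ d ⟩
    coeff (p * q′) d  ≡⟨ *-comm p q′ d ⟩
    coeff (q′ * p) d  ≡⟨ *-congˡ q′ p≈p′ d ⟩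
    coeff (q′ * p′) d ≡⟨ *-comm q′ p′ d ⟩
    coeff (p′ * q′) d ∎

  *-distribʳ : ∀ r p q → (p ++ q) * r ≡ p * r ++ q * r
  *-distribʳ r p q = List.cartesianProductWith-distribʳ-++ _·_ p q r

  map-·-* : ∀ x p q → map (x ·_) p * q ≡ map (x ·_) (p * q)
  map-·-* x []      q = refl
  map-·-* x (y ∷ p) q = begin
    map ((x · y) ·_) q ++ map (x ·_) p * q
      ≡⟨ cong₂ _++_ (trans (List.map-cong (·-assoc x y) q) (List.map-∘ q)) (map-·-* x p q) ⟩
    map (x ·_) (map (y ·_) q) ++ map (x ·_) (p * q)
      ≡⟨ List.map-++ (x ·_) (map (y ·_) q) (p * q) ⟨
    map (x ·_) ((y ∷ p) * q) ∎

  *-assoc : ∀ p q r → (p * q) * r ≡ p * (q * r)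
  *-assoc []      q r = refl
  *-assoc (x ∷ p) q r = trans (*-distribʳ r (map (x ·_) q) (p * q))
    (cong₂ _++_ (map-·-* x q r) (*-assoc p q r))

  *-identityˡ : ∀ p → 1# * p ≡ p
  *-identityˡ p = trans (List.++-identityʳ _) (trans (List.map-cong identity p) (List.map-id p))
    where
    identity : ∀ x → (1ℤ , 0ℤ) · x ≡ x
    identity (c , e) = cong₂ _,_ (ℤ.*-identityˡ c) (ℤ.+-identityˡ e)

  ≡⇒≈ : ∀ {p q} → p ≡ q → p ≈ q
  ≡⇒≈ p≡q d = cong (λ r → coeff r d) p≡q

  commutativeRing : CommutativeRing 0ℓ 0ℓ
  commutativeRing = record
    { Carrier = Laurent
    ; _≈_ = _≈_
    ; _+_ = _+_
    ; _*_ = _*_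
    ; -_  = -_
    ; 0#  = 0#
    ; 1#  = 1#
    ; isCommutativeRing = record
      { isRing = record
        { +-isAbelianGroup = record
          { isGroup = record
            { isMonoid = record
              { isSemigroup = record
                { isMagma = record
                  { isEquivalence = record
                    { refl  = λ _ → refl
                    ; sym   = λ p≈q d → sym (p≈q d)
                    ; trans = λ p≈q q≈r d → trans (p≈q d) (q≈r d)
                    }
                  ; ∙-cong = λ {p} {p′} {q} {q′} → ++-cong {p} {p′} {q} {q′}
                  }
                ; assoc = λ p q r → ≡⇒≈ (List.++-assoc p q r)
                }
              ; identity = (λ p d → refl) , (λ p → ≡⇒≈ (List.++-identityʳ p))
              }
            ; inverse = (λ p d → trans (++-comm (- p) p d) (++-inverseʳ p d)) , ++-inverseʳ
            ; ⁻¹-cong = λ {p} {q} → neg-cong {p} {q}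
            }
          ; comm = ++-comm
          }
        ; *-cong = λ {p} {p′} {q} {q′} → *-cong {p} {p′} {q} {q′}
        ; *-assoc = λ p q r → ≡⇒≈ (*-assoc p q r)
        ; *-identity = (λ p → ≡⇒≈ (*-identityˡ p))
                     , (λ p d → trans (*-comm p 1# d) (≡⇒≈ (*-identityˡ p) d))
        ; distrib = (λ p q r d → trans (*-comm p (q ++ r) d)
                       (trans (≡⇒≈ (*-distribʳ p q r) d)
                         (++-cong {q * p} {p * q} {r * p} {p * r} (*-comm q p) (*-comm r p) d)))
                  , (λ p q r → ≡⇒≈ (*-distribʳ p q r))
        }
      ; *-comm = *-comm
      }
    }

  const-+ : ∀ a b → const (a ℤ.+ b) ≈ const a + const b
  const-+ a b d with does (0ℤ ℤ.≟ d)
  ... | true  = ℤ.+-assoc a b 0ℤ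
  ... | false = refl

  const-0 : const 0ℤ ≈ 0#
  const-0 d = cong (λ z → z ℤ.+ 0ℤ) (if-eta (does (0ℤ ℤ.≟ d)))

  t^-^ : ∀ e k → (t^ e) ^ k ≈ t^ (+ k ℤ.* e)
  t^-^ e zero    = λ _ → refl
  t^-^ e (suc k) d = begin
    coeff (t^ e * (t^ e) ^ k) d
      ≡⟨ *-congˡ (t^ e) {(t^ e) ^ k} {t^ (+ k ℤ.* e)} (t^-^ e k) d ⟩
    coeff (t^ (e ℤ.+ + k ℤ.* e)) d
      ≡⟨ cong (λ i → coeff (t^ i) d) (ℤ.suc-* (+ k) e) ⟨
    coeff (t^ (+ suc k ℤ.* e)) d ∎

-- Determinants from Laplace expansion: transposition and row operations.

module Determinant {c ℓ} (R : CommutativeRing c ℓ) where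
  open CommutativeRing R hiding (zero)
  open RawSemiringDefs (Semiring.rawSemiring semiring) using (_^_)
  open RingProperties ring using (-1*x≈-x)
  open SemiringSum semiring
    using (sum; sum-cong-≋; sum-replicate-zero; *-distribˡ-sum; ∑-distrib-+; ∑-comm)
  open SemiringSolver commutativeSemiring using (solve; _:+_; _:*_; _:=_)
  open SetoidReasoning setoid

  Matrix : ℕ → Set c
  Matrix n = Fin n → Fin n → Carrier

  Δ : ∀ {n} → Matrix n → Carrier
  Δ = det rawRing

  sgn : ∀ {n} → Fin n → Carrier
  sgn i = (- 1#) ^ toℕ i

  minor : ∀ {n} → Fin (suc n) → Matrix (suc n) → Matrix n
  minor j M i k = M (suc i) (punchIn j k)

  x-1*x≈0 : ∀ x → x + - 1# * x ≈ 0#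
  x-1*x≈0 x = trans (+-congˡ (-1*x≈-x x)) (-‿inverseʳ x)

  sum-zero : ∀ {n} {f : Fin n → Carrier} → (∀ i → f i ≈ 0#) → sum f ≈ 0#
  sum-zero {n} f≈0 = trans (sum-cong-≋ f≈0) (sum-replicate-zero n)

  det-cong : ∀ {n} {M N : Matrix n} → (∀ i j → M i j ≈ N i j) → Δ M ≈ Δ N
  det-cong {zero}  M≈N = refl
  det-cong {suc n} M≈N = sum-cong-≋ λ j → *-congˡ {sgn j}
    (*-cong (M≈N zero j) (det-cong λ i k → M≈N (suc i) (punchIn j k)))

  -- Both sides multiply out to the same double sum. In the application x and y are the first row
  -- and first column without the corner, s and r their signs, d the minors with both lines deleted;
  -- each -1 is the sign of the shift from j to `suc j`.
  sum-exchange : ∀ {m n} (x s : Fin m → Carrier) (y r : Fin n → Carrier)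
    (d : Fin m → Fin n → Carrier) →
    sum (λ j → - 1# * s j * (x j * sum λ i → r i * (y i * d j i))) ≈
    sum (λ i → - 1# * r i * (y i * sum λ j → s j * (x j * d j i)))
  sum-exchange x s y r d = begin
    sum (λ j → - 1# * s j * (x j * sum λ i → r i * (y i * d j i)))
      ≈⟨ sum-cong-≋ (λ j → push (s j) (x j) (λ i → r i * (y i * d j i))) ⟩
    sum (λ j → sum λ i → - 1# * s j * x j * (r i * (y i * d j i)))
      ≈⟨ ∑-comm (λ j i → - 1# * s j * x j * (r i * (y i * d j i))) ⟩
    sum (λ i → sum λ j → - 1# * s j * x j * (r i * (y i * d j i)))
      ≈⟨ sum-cong-≋ (λ i → sum-cong-≋ λ j → solve 6
           (λ m s x r y d → m :* s :* x :* (r :* (y :* d)) := m :* r :* y :* (s :* (x :* d)))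
           refl (- 1#) (s j) (x j) (r i) (y i) (d j i)) ⟩
    sum (λ i → sum λ j → - 1# * r i * y i * (s j * (x j * d j i)))
      ≈⟨ sum-cong-≋ (λ i → push (r i) (y i) (λ j → s j * (x j * d j i))) ⟨
    sum (λ i → - 1# * r i * (y i * sum λ j → s j * (x j * d j i))) ∎
    where
    push : ∀ {n} s x (f : Fin n → Carrier) →
      - 1# * s * (x * sum f) ≈ sum λ i → - 1# * s * x * f i
    push s x f = trans (sym (*-assoc (- 1# * s) x (sum f))) (*-distribˡ-sum (- 1# * s * x) f)

  -- The corner term is common to both expansions. Every other first-row minor still starts with
  -- part of column zero, so it is expanded along that column by induction and the two sums are
  -- exchanged.
  det-column-expansion : ∀ {n} (M : Matrix (suc n)) →
    Δ M ≈ sum λ i → sgn i * (M i zero * Δ λ k j → M (punchIn i k) (suc j))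
  det-column-expansion {zero}  M = refl
  det-column-expansion {suc n} M = +-congˡ (begin
    sum (λ j → sgn (suc j) * (M zero (suc j) * Δ (minor (suc j) M)))
      ≈⟨ sum-cong-≋ (λ j → *-congˡ {sgn (suc j)}
           (*-congˡ {M zero (suc j)} (det-column-expansion (minor (suc j) M)))) ⟩
    _ ≈⟨ sum-exchange (M zero ∘ suc) sgn (flip M zero ∘ suc) sgn
           (λ j i → Δ λ k l → M (suc (punchIn i k)) (suc (punchIn j l))) ⟩
    sum (λ i → sgn (suc i) * (M (suc i) zero * Δ λ k j → M (punchIn (suc i) k) (suc j))) ∎)

  det-transpose : ∀ {n} (M : Matrix n) → Δ (flip M) ≈ Δ M
  det-transpose {zero}  M = refl
  det-transpose {suc n} M = begin
    Δ (flip M)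
      ≈⟨ sum-cong-≋ (λ i → *-congˡ {sgn i}
           (*-congˡ {M i zero} (det-transpose λ k j → M (punchIn i k) (suc j)))) ⟩
    sum (λ i → sgn i * (M i zero * Δ λ k j → M (punchIn i k) (suc j)))
      ≈⟨ det-column-expansion M ⟨
    Δ M ∎

  -- In the first-row expansion the first two terms have equal entries and equal minors but opposite
  -- signs, so they cancel. The remaining minors keep both equal columns and vanish by induction.
  det-equal-columns : ∀ {n} (M : Matrix (suc (suc n))) →
    (∀ i → M i zero ≈ M i (suc zero)) → Δ M ≈ 0#
  det-equal-columns {n} M M₀≈M₁ = begin
    1# * (α * x) + (- 1# * 1# * (β * y) + rest)
      ≈⟨ +-congʳ (*-congˡ (*-cong (M₀≈M₁ zero) (det-cong minor₀≈minor₁))) ⟩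
    1# * (β * y) + (- 1# * 1# * (β * y) + rest)
      ≈⟨ solve 5 (λ o m b y r → o :* (b :* y) :+ (m :* o :* (b :* y) :+ r) :=
                    (o :* (b :* y) :+ m :* (o :* (b :* y))) :+ r) refl 1# (- 1#) β y rest ⟩
    1# * (β * y) + - 1# * (1# * (β * y)) + rest
      ≈⟨ +-cong (x-1*x≈0 _) (rest≈0 M M₀≈M₁) ⟩
    0# + 0#
      ≈⟨ +-identityˡ 0# ⟩
    0# ∎
    where
    α β x y rest : Carrier
    α = M zero zero
    β = M zero (suc zero)
    x = Δ (minor zero M)
    y = Δ (minor (suc zero) M)
    rest = sum λ j → sgn (suc (suc j)) * (M zero (suc (suc j)) * Δ (minor (suc (suc j)) M))

    minor₀≈minor₁ : ∀ i k → minor zero M i k ≈ minor (suc zero) M i k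
    minor₀≈minor₁ i zero    = sym (M₀≈M₁ (suc i))
    minor₀≈minor₁ i (suc k) = refl

    -- The size is split here: in size two the sum is empty, and only from size three on do the
    -- minors have two columns to compare.
    rest≈0 : ∀ {n} (M : Matrix (suc (suc n))) → (∀ i → M i zero ≈ M i (suc zero)) →
      sum (λ j → sgn (suc (suc j)) * (M zero (suc (suc j)) * Δ (minor (suc (suc j)) M))) ≈ 0#
    rest≈0 {zero}  M M₀≈M₁ = refl
    rest≈0 {suc n} M M₀≈M₁ = sum-zero λ j → trans
      (*-congˡ {sgn (suc (suc j))} (trans
        (*-congˡ {M zero (suc (suc j))} (det-equal-columns (minor (suc (suc j)) M) (M₀≈M₁ ∘ suc)))
        (zeroʳ _)))
      (zeroʳ _)

  det-equal-rows : ∀ {n} (M : Matrix (suc (suc n))) →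
    (∀ j → M zero j ≈ M (suc zero) j) → Δ M ≈ 0#
  det-equal-rows M M₀≈M₁ = trans (sym (det-transpose M)) (det-equal-columns (flip M) M₀≈M₁)

  det-scale : ∀ {n} x (M : Matrix n) → Δ (λ i j → x * M i j) ≈ x ^ n * Δ M
  det-scale {zero}  x M = sym (*-identityˡ 1#)
  det-scale {suc n} x M = begin
    sum (λ j → sgn j * (x * M zero j * Δ λ i k → x * minor j M i k))
      ≈⟨ sum-cong-≋ (λ j → trans
           (*-congˡ {sgn j} (*-congˡ {x * M zero j} (det-scale x (minor j M))))
           (solve 5 (λ s x m p d → s :* (x :* m :* (p :* d)) := x :* p :* (s :* (m :* d)))
              refl (sgn j) x (M zero j) (x ^ n) (Δ (minor j M)))) ⟩
    sum (λ j → x ^ suc n * (sgn j * (M zero j * Δ (minor j M))))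
      ≈⟨ *-distribˡ-sum (x ^ suc n) (λ j → sgn j * (M zero j * Δ (minor j M))) ⟨
    x ^ suc n * Δ M ∎

  module _ {n} (x : Carrier) (M N : Matrix (suc (suc n)))
    (M₀ : ∀ j → M zero j ≈ N zero j)
    (M₁ : ∀ j → M (suc zero) j ≈ N (suc zero) j + x * N zero j)
    (M₂₊ : ∀ i j → M (suc (suc i)) j ≈ N (suc (suc i)) j) where

    private
      N′ : Matrix (suc (suc n))
      N′ zero          = N zero
      N′ (suc zero)    = N zero
      N′ (suc (suc i)) = N (suc (suc i))

    -- Expanding twice shows linearity in the second row, so the difference is x times the
    -- determinant of `N′`, where the first row of `N` occurs twice.
    det-add-first-to-second-row : Δ M ≈ Δ N
    det-add-first-to-second-row = begin
      Δ M
        ≈⟨ sum-cong-≋ (λ j → trans (*-congˡ {sgn j} (*-cong (M₀ j) (trans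
             (sum-cong-≋ λ k → split j k) (∑-distrib-+ (term N j) (λ k → x * term N′ j k)))))
             (distrib₃ (sgn j) (N zero j) _ _)) ⟩
      sum (λ j → sgn j * (N zero j * sum (term N j)) + sgn j * (N zero j * sum (λ k → x * term N′ j k)))
        ≈⟨ ∑-distrib-+ (λ j → sgn j * (N zero j * sum (term N j)))
                    (λ j → sgn j * (N zero j * sum (λ k → x * term N′ j k))) ⟩
      Δ N + sum (λ j → sgn j * (N zero j * sum (λ k → x * term N′ j k)))
        ≈⟨ +-congˡ (sum-cong-≋ λ j → trans
             (*-congˡ {sgn j} (*-congˡ {N zero j} (sym (*-distribˡ-sum x (term N′ j)))))
             (solve 4 (λ s a x y → s :* (a :* (x :* y)) := x :* (s :* (a :* y)))
                refl (sgn j) (N zero j) x (sum (term N′ j)))) ⟩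
      Δ N + sum (λ j → x * (sgn j * (N′ zero j * sum (term N′ j))))
        ≈⟨ +-congˡ (*-distribˡ-sum x (λ j → sgn j * (N′ zero j * sum (term N′ j)))) ⟨
      Δ N + x * Δ N′
        ≈⟨ +-congˡ (trans (*-congˡ (det-equal-rows N′ λ _ → refl)) (zeroʳ x)) ⟩
      Δ N + 0#
        ≈⟨ +-identityʳ (Δ N) ⟩
      Δ N ∎
      where
      term : Matrix (suc (suc n)) → Fin (suc (suc n)) → Fin (suc n) → Carrier
      term P j k = sgn k * (P (suc zero) (punchIn j k) * Δ (minor k (minor j P)))

      distrib₃ : ∀ s a x y → s * (a * (x + y)) ≈ s * (a * x) + s * (a * y)
      distrib₃ = solve 4 (λ s a x y → s :* (a :* (x :+ y)) := s :* (a :* x) :+ s :* (a :* y)) refl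

      split : ∀ j k → term M j k ≈ term N j k + x * term N′ j k
      split j k = begin
        term M j k
          ≈⟨ *-congˡ {sgn k} (*-cong (M₁ (punchIn j k)) (det-cong λ i l → M₂₊ i _)) ⟩
        sgn k * ((N (suc zero) (punchIn j k) + x * N zero (punchIn j k)) * Δ (minor k (minor j N)))
          ≈⟨ solve 5 (λ s a x b d → s :* ((a :+ x :* b) :* d) := s :* (a :* d) :+ x :* (s :* (b :* d)))
               refl (sgn k) (N (suc zero) (punchIn j k)) x (N zero (punchIn j k)) (Δ (minor k (minor j N))) ⟩
        term N j k + x * term N′ j k ∎

  -- U is V multiplied by a unitriangular bidiagonal matrix. Row 1 is corrected first, by means of
  -- row 0; then the minors of the first-row expansion have V 1 on top and satisfy the same
  -- hypotheses one index later.
  det-add-previous-rows : ∀ {n} x (U V : ℕ → Fin n → Carrier) →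
    (∀ j → U 0 j ≈ V 0 j) →
    (∀ i j → U (suc i) j ≈ V (suc i) j + x * V i j) →
    Δ (λ i j → U (toℕ i) j) ≈ Δ (λ i j → V (toℕ i) j)
  det-add-previous-rows {zero}        x U V U₀ U₊ = refl
  det-add-previous-rows {suc zero}    x U V U₀ U₊ =
    det-cong {1} {λ i j → U (toℕ i) j} {λ i j → V (toℕ i) j} λ { zero j → U₀ j }
  det-add-previous-rows {suc (suc n)} x U V U₀ U₊ = begin
    Δ (λ i j → U (toℕ i) j)
      ≈⟨ det-add-first-to-second-row x (λ i j → U (toℕ i) j) (λ i j → W (toℕ i) j)
           U₀ (U₊ 0) (λ _ _ → refl) ⟩
    Δ (λ i j → W (toℕ i) j)
      ≈⟨ sum-cong-≋ (λ j → *-congˡ {sgn j} (*-congˡ {V 0 j} (det-add-previous-rows x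
           (λ i k → W (suc i) (punchIn j k)) (λ i k → V (suc i) (punchIn j k))
           (λ _ → refl) (λ i k → U₊ (suc i) (punchIn j k))))) ⟩
    Δ (λ i j → V (toℕ i) j) ∎
    where
    -- The intermediate stage: rows 0 and 1 are already those of V, the later ones still those of U.
    W : ℕ → Fin (suc (suc n)) → Carrier
    W 0             = V 0
    W 1             = V 1
    W (suc (suc i)) = U (suc (suc i))

-- The Jacobi operator J and determinants of its orbits.

module Jacobi {c ℓ} (R : CommutativeRing c ℓ) (t : CommutativeRing.Carrier R) where
  open CommutativeRing R hiding (zero)
  open RawSemiringDefs (Semiring.rawSemiring semiring) using (_^_)
  open SemiringSum semiring using (sum; sum-cong-≋)
  open SemiringSolver commutativeSemiring using (solve; _:+_; _:*_; _:=_; con)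
  open SetoidReasoning setoid
  open Determinant R

  J : (ℕ → Carrier) → ℕ → Carrier
  J f zero    = f 1 + (1# + t) * f 0
  J f (suc k) = f (2 ℕ.+ k) + (1# + t) * f (suc k) + t * f k

  J-cong : ∀ {f g} → (∀ k → f k ≈ g k) → ∀ k → J f k ≈ J g k
  J-cong f≈g zero    = +-cong (f≈g 1) (*-congˡ (f≈g 0))
  J-cong f≈g (suc k) =
    +-cong (+-cong (f≈g (2 ℕ.+ k)) (*-congˡ (f≈g (suc k)))) (*-congˡ (f≈g k))

  -- The two copies of J act on different indices and have scalar coefficients.
  J-commutes : ∀ (f : ℕ → ℕ → Carrier) k l →
    J (λ i → J (f i) l) k ≈ J (λ j → J (λ i → f i j) k) l
  J-commutes f zero    zero    = solve 5 (λ s a b c d →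
    (a :+ s :* b) :+ s :* (c :+ s :* d) := (a :+ s :* c) :+ s :* (b :+ s :* d))
    refl (1# + t) (f 1 1) (f 1 0) (f 0 1) (f 0 0)
  J-commutes f zero    (suc l) = solve 8 (λ s t a b c d e g →
    (a :+ s :* b :+ t :* c) :+ s :* (d :+ s :* e :+ t :* g) :=
    (a :+ s :* d) :+ s :* (b :+ s :* e) :+ t :* (c :+ s :* g))
    refl (1# + t) t (f 1 (2 ℕ.+ l)) (f 1 (suc l)) (f 1 l) (f 0 (2 ℕ.+ l)) (f 0 (suc l)) (f 0 l)
  J-commutes f (suc k) zero    = sym (J-commutes (flip f) zero (suc k))
  J-commutes f (suc k) (suc l) = solve 11 (λ s t a b c d e g h i j →
    (a :+ s :* b :+ t :* c) :+ s :* (d :+ s :* e :+ t :* g) :+ t :* (h :+ s :* i :+ t :* j) :=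
    (a :+ s :* d :+ t :* h) :+ s :* (b :+ s :* e :+ t :* i) :+ t :* (c :+ s :* g :+ t :* j))
    refl (1# + t) t
    (f (2 ℕ.+ k) (2 ℕ.+ l)) (f (2 ℕ.+ k) (suc l)) (f (2 ℕ.+ k) l)
    (f (suc k) (2 ℕ.+ l)) (f (suc k) (suc l)) (f (suc k) l)
    (f k (2 ℕ.+ l)) (f k (suc l)) (f k l)

  -- By J, w i 0 is w 0 i plus a combination of w 0 0, …, w 0 (i-1).
  det-J-orbit : ∀ {n} (w : ℕ → ℕ → Fin n → Carrier) →
    (∀ i k j → w (suc i) k j ≈ J (λ l → w i l j) k) →
    Δ (λ i j → w (toℕ i) 0 j) ≈ Δ (λ i j → w 0 (toℕ i) j)
  det-J-orbit {zero}  w w₊ = refl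
  det-J-orbit {suc n} w w₊ = begin
    Δ (λ i j → w (toℕ i) 0 j)
      -- The rows below the first are the orbit started at `w 1`. Induction inside the minors turns
      -- them into `w 1 0`, `w 1 1`, and so on.
      ≈⟨ sum-cong-≋ (λ j → *-congˡ {sgn j} (*-congˡ {w 0 0 j}
           (det-J-orbit (λ i k l → w (suc i) k (punchIn j l)) (λ i k l → w₊ (suc i) k (punchIn j l))))) ⟩
    Δ (λ i j → first-step (toℕ i) j)
      ≈⟨ det-add-previous-rows 1# first-step half-step (λ _ → refl) first-step≈ ⟩
    Δ (λ i j → half-step (toℕ i) j)
      ≈⟨ det-add-previous-rows t half-step (w 0) (λ _ → refl) (λ _ _ → refl) ⟩
    Δ (λ i j → w 0 (toℕ i) j) ∎
    where
    -- With σ the forward shift and β the backward shift padded by 0, J = (σ + 1)(1 + t β) since σ β = 1.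
    first-step half-step : ℕ → Fin (suc n) → Carrier
    first-step zero    = w 0 0
    first-step (suc k) = w 1 k

    half-step zero    = w 0 0
    half-step (suc k) j = w 0 (suc k) j + t * w 0 k j

    first-step≈ : ∀ k j → first-step (suc k) j ≈ half-step (suc k) j + 1# * half-step k j
    first-step≈ zero    j = trans (w₊ 0 0 j) (solve 3 (λ t a b →
      a :+ (con 1 :+ t) :* b := (a :+ t :* b) :+ con 1 :* b) refl t (w 0 1 j) (w 0 0 j))
    first-step≈ (suc k) j = trans (w₊ 0 (suc k) j) (solve 4 (λ t a b c →
      a :+ (con 1 :+ t) :* b :+ t :* c := (a :+ t :* b) :+ con 1 :* (b :+ t :* c))
      refl t (w 0 (2 ℕ.+ k) j) (w 0 (suc k) j) (w 0 k j))

  -- The tridiagonal matrix T and the Hankel determinant of its J-orbit.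

  -- T k l = t^min(k,l) for |k-l| ≤ 1, and 0 otherwise.
  T : ℕ → ℕ → Carrier
  T zero    l       = border l
    where
    border : ℕ → Carrier
    border zero          = 1#
    border (suc zero)    = 1#
    border (suc (suc _)) = 0#
  T (suc k) zero    = T zero (suc k)
  T (suc k) (suc l) = t * T k l

  T-J-symmetric : ∀ k l → J (λ i → T i l) k ≈ J (T k) l
  T-J-symmetric zero    zero    = refl
  T-J-symmetric zero    (suc l) = solve 4 (λ s t a b →
    t :* a :+ s :* b := con 0 :+ s :* b :+ t :* a) refl (1# + t) t (T 0 l) (T 0 (suc l))
  T-J-symmetric (suc k) zero    = solve 4 (λ s t a b →
    con 0 :+ s :* b :+ t :* a := t :* a :+ s :* b) refl (1# + t) t (T k 0) (T (suc k) 0)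
  T-J-symmetric (suc k) (suc l) = solve 5 (λ s t a b d →
    t :* a :+ s :* (t :* b) :+ t :* d := t :* d :+ s :* (t :* b) :+ t :* a)
    refl (1# + t) t (T (suc k) l) (T k l) (T k (suc l))

  -- The matrix product Jⁱ T, with J acting on the row index.
  W : ℕ → ℕ → ℕ → Carrier
  W zero    k l = T k l
  W (suc i) k l = J (λ k′ → W i k′ l) k

  -- Symmetry of J T moves one J to the column index, and there it commutes with all the others. So
  -- J may act on either index of W.
  W-J-symmetric : ∀ i k l → W (suc i) k l ≈ J (W i k) l
  W-J-symmetric zero    k l = T-J-symmetric k l
  W-J-symmetric (suc i) k l = trans
    (J-cong (λ k′ → W-J-symmetric i k′ l) k)
    (J-commutes (W i) k l)

  -- The unitriangular factors A and Aᵀ are stripped one at a time by row operations: first with J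
  -- acting on the column index of W, then, after a transposition, with J acting on the row index.
  det-hankel : ∀ n → Δ {n} (λ i j → W (toℕ i ℕ.+ toℕ j) 0 0) ≈ Δ {n} (λ i j → T (toℕ i) (toℕ j))
  det-hankel n = begin
    Δ {n} (λ i j → W (toℕ i ℕ.+ toℕ j) 0 0)
      ≈⟨ det-J-orbit {n} (λ i k j → W (i ℕ.+ toℕ j) 0 k) (λ i k j → W-J-symmetric (i ℕ.+ toℕ j) 0 k) ⟩
    Δ {n} (λ i j → W (toℕ j) 0 (toℕ i))
      ≈⟨ det-transpose {n} (λ i j → W (toℕ i) 0 (toℕ j)) ⟩
    Δ {n} (λ i j → W (toℕ i) 0 (toℕ j))
      ≈⟨ det-J-orbit {n} (λ i k j → W i k (toℕ j)) (λ _ _ _ → refl) ⟩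
    Δ {n} (λ i j → T (toℕ i) (toℕ j)) ∎

  det-T : ℕ → Carrier
  det-T n = Δ {n} (λ i j → T (toℕ i) (toℕ j))

  -- The first row of T is 1, 1, 0, ..., which leaves two minors. The first is t times a smaller T.
  -- The second has first column 1, 0, ..., and below its corner stands t² times a T of size n.
  det-T-recurrence : ∀ n →
    det-T (2 ℕ.+ n) ≈ t ^ suc n * det-T (suc n) + - 1# * (t ^ n * t ^ n * det-T n)
  det-T-recurrence n = begin
    1# * (1# * Δ (minor zero M)) + (- 1# * 1# * (1# * Δ (minor (suc zero) M)) + rest)
      ≈⟨ +-cong (*-congˡ (*-congˡ (det-scale {suc n} t (λ i j → T (toℕ i) (toℕ j)))))
                (+-cong (*-congˡ (*-congˡ minor₁)) rest≈0) ⟩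
    1# * (1# * (t ^ suc n * det-T (suc n))) + (- 1# * 1# * (1# * (t ^ n * (t ^ n * det-T n))) + 0#)
      ≈⟨ solve 4 (λ m x y p → con 1 :* (con 1 :* x) :+ (m :* con 1 :* (con 1 :* (p :* (p :* y))) :+ con 0)
                                := x :+ m :* (p :* p :* y))
           refl (- 1#) (t ^ suc n * det-T (suc n)) (det-T n) (t ^ n) ⟩
    t ^ suc n * det-T (suc n) + - 1# * (t ^ n * t ^ n * det-T n) ∎
    where
    M : Matrix (2 ℕ.+ n)
    M i j = T (toℕ i) (toℕ j)

    rest : Carrier
    rest = sum λ j → sgn (suc (suc j)) * (M zero (suc (suc j)) * Δ (minor (suc (suc j)) M))

    rest≈0 : rest ≈ 0#
    rest≈0 = sum-zero {n} λ j → trans (*-congˡ (zeroˡ _)) (zeroʳ _)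

    N : Matrix (suc n)
    N = minor (suc zero) M

    N₊ : Matrix n
    N₊ i j = N (suc i) (suc j)

    minor₁ : Δ N ≈ t ^ n * (t ^ n * det-T n)
    minor₁ = begin
      Δ N
        ≈⟨ det-column-expansion N ⟩
      1# * (1# * Δ N₊) + sum (λ i → sgn (suc i) * (N (suc i) zero * Δ λ k j → N (punchIn (suc i) k) (suc j)))
        ≈⟨ +-congˡ (sum-zero {n} λ i → trans (*-congˡ (zeroˡ _)) (zeroʳ _)) ⟩
      1# * (1# * Δ N₊) + 0#
        ≈⟨ trans (+-identityʳ _) (trans (*-identityˡ _) (*-identityˡ _)) ⟩
      Δ N₊
        ≈⟨ det-scale t (λ i j → t * M′ i j) ⟩
      t ^ n * Δ (λ i j → t * M′ i j)
        ≈⟨ *-congˡ (det-scale t M′) ⟩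
      t ^ n * (t ^ n * det-T n) ∎
      where
      M′ : Matrix n
      M′ i j = T (toℕ i) (toℕ j)

  -- The array a on odd indices, and its match with the first row of Jⁿ T.

  a′ : ℕ → ℤ → Carrier
  a′ = a rawRing t

  a-suc : ∀ n m → a′ (suc n) (+ suc m) ≡
    a′ n (+ m) + weighted rawRing t (parity (suc m)) (a′ n (+ suc (suc m)))
  a-suc n m = ≡.cong (λ k → a′ n (+ m) + weighted rawRing t (parity (suc m)) (a′ n (+ suc k))) (ℕ.+-comm m 1)

  parity-even : ∀ k → parity (k ℕ.* 2) ≡ 0ℙ
  parity-even zero    = ≡.refl
  parity-even (suc k) = parity-even k

  parity-odd : ∀ k → parity (suc (k ℕ.* 2)) ≡ 1ℙ
  parity-odd zero    = ≡.refl
  parity-odd (suc k) = parity-odd k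

  -- The entry a(2n+1, 2k+1). Doubling is written `k ℕ.* 2` because `suc k ℕ.* 2` then reduces to
  -- two successors.
  odd : ℕ → ℕ → Carrier
  odd n k = a′ (suc (n ℕ.* 2)) (+ suc (k ℕ.* 2))

  a-even : ∀ n k → a′ (suc n ℕ.* 2) (+ (suc k ℕ.* 2)) ≡ odd n k + odd n (suc k)
  a-even n k = ≡.trans (a-suc (suc (n ℕ.* 2)) (suc (k ℕ.* 2)))
    (≡.cong (λ p → odd n k + weighted rawRing t p (odd n (suc k))) (parity-even k))

  -- Two steps of the array pass through the even columns. Once these are eliminated, the odd
  -- columns evolve by the transpose of J; this is its border row, `odd-suc-suc` gives the others.
  odd-suc-zero : ∀ n → odd (suc n) 0 ≈ (1# + t) * odd n 0 + t * odd n 1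
  odd-suc-zero n = trans
    -- Column 0 receives 0 from column -1, so its entry is `odd n 0` alone.
    (+-cong (+-identityˡ (odd n 0)) (*-congˡ (reflexive (a-even n 0))))
    (solve 3 (λ t a b → a :+ t :* (a :+ b) := (con 1 :+ t) :* a :+ t :* b) refl t (odd n 0) (odd n 1))

  odd-suc-suc : ∀ n k → odd (suc n) (suc k) ≈ odd n k + (1# + t) * odd n (suc k) + t * odd n (2 ℕ.+ k)
  odd-suc-suc n k = begin
    odd (suc n) (suc k)
      ≡⟨ ≡.trans (a-suc (suc n ℕ.* 2) (suc k ℕ.* 2))
           (≡.cong₂ _+_ (a-even n k) (≡.cong₂ (weighted rawRing t) (parity-odd k) (a-even n (suc k)))) ⟩
    (odd n k + odd n (suc k)) + t * (odd n (suc k) + odd n (2 ℕ.+ k))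
      ≈⟨ solve 4 (λ t a b c → (a :+ b) :+ t :* (b :+ c) := a :+ (con 1 :+ t) :* b :+ t :* c)
           refl t (odd n k) (odd n (suc k)) (odd n (2 ℕ.+ k)) ⟩
    odd n k + (1# + t) * odd n (suc k) + t * odd n (2 ℕ.+ k) ∎

  odd-zero-zero : odd 0 0 ≈ 1#
  odd-zero-zero = trans (+-congˡ (zeroʳ t)) (+-identityʳ 1#)

  odd-zero-suc : ∀ k → odd 0 (suc k) ≈ 0#
  odd-zero-suc k = begin
    odd 0 (suc k)
      ≡⟨ ≡.cong (λ p → 0# + weighted rawRing t p 0#) (parity-odd k) ⟩
    0# + t * 0#
      ≈⟨ trans (+-identityˡ (t * 0#)) (zeroʳ t) ⟩
    0# ∎

  -- The vector Jⁿ (1, 1, 0, …); powers of t appear because diag(tᵏ) conjugates J to its transpose.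
  profile : ℕ → ℕ → Carrier
  profile n zero    = odd n 0 + odd n 1
  profile n (suc k) = t ^ k * (odd n k + t * (odd n (suc k) + odd n (2 ℕ.+ k)))

  -- Put g(n,k) = tᵏ · `odd n k`. Then g(n+1) = J g(n), and t · `profile n` = (J - 1) g(n), where J
  -- - 1 commutes with J. The cases below verify the relation with the factor t already cancelled.
  profile-J : ∀ n k → profile (suc n) k ≈ J (profile n) k
  profile-J n zero = trans (+-cong (odd-suc-zero n) (odd-suc-suc n 0))
    (solve 4 (λ t a b c →
      ((con 1 :+ t) :* a :+ t :* b) :+ (a :+ (con 1 :+ t) :* b :+ t :* c) :=
      con 1 :* (a :+ t :* (b :+ c)) :+ (con 1 :+ t) :* (a :+ b))
      refl t (odd n 0) (odd n 1) (odd n 2))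
  profile-J n (suc zero) = trans
    (*-congˡ (+-cong (odd-suc-zero n) (*-congˡ (+-cong (odd-suc-suc n 0) (odd-suc-suc n 1)))))
    (solve 5 (λ t a b c d →
      con 1 :* (((con 1 :+ t) :* a :+ t :* b) :+
        t :* ((a :+ (con 1 :+ t) :* b :+ t :* c) :+ (b :+ (con 1 :+ t) :* c :+ t :* d))) :=
      (t :* con 1) :* (b :+ t :* (c :+ d)) :+ (con 1 :+ t) :* (con 1 :* (a :+ t :* (b :+ c))) :+ t :* (a :+ b))
      refl t (odd n 0) (odd n 1) (odd n 2) (odd n 3))
  profile-J n (suc (suc k)) = trans
    (*-congˡ (+-cong (odd-suc-suc n k) (*-congˡ (+-cong (odd-suc-suc n (suc k)) (odd-suc-suc n (2 ℕ.+ k))))))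
    (solve 7 (λ t p z a b c d →
      (t :* p) :* ((z :+ (con 1 :+ t) :* a :+ t :* b) :+
        t :* ((a :+ (con 1 :+ t) :* b :+ t :* c) :+ (b :+ (con 1 :+ t) :* c :+ t :* d))) :=
      (t :* (t :* p)) :* (b :+ t :* (c :+ d)) :+
        (con 1 :+ t) :* ((t :* p) :* (a :+ t :* (b :+ c))) :+ t :* (p :* (z :+ t :* (a :+ b))))
      refl t (t ^ k) (odd n k) (odd n (suc k)) (odd n (2 ℕ.+ k)) (odd n (3 ℕ.+ k)) (odd n (4 ℕ.+ k)))

  -- Both sides are J-orbits started at (1, 1, 0, ...), the first row of T. By `W-J-symmetric` the
  -- first row of W evolves on its own.
  W≈profile : ∀ n k → W n 0 k ≈ profile n k
  W≈profile zero    zero          = sym (trans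
    (+-cong odd-zero-zero (odd-zero-suc 0)) (+-identityʳ 1#))
  W≈profile zero    (suc zero)    = sym (trans
    (*-congˡ (+-cong odd-zero-zero (*-congˡ (+-cong (odd-zero-suc 0) (odd-zero-suc 1)))))
    (solve 1 (λ t → con 1 :* (con 1 :+ t :* (con 0 :+ con 0)) := con 1) refl t))
  W≈profile zero    (suc (suc k)) = sym (trans
    (*-congˡ (+-cong (odd-zero-suc k) (*-congˡ (+-cong (odd-zero-suc (suc k)) (odd-zero-suc (2 ℕ.+ k))))))
    (solve 2 (λ p t → p :* (con 0 :+ t :* (con 0 :+ con 0)) := con 0) refl (t ^ suc k) t))
  W≈profile (suc n) k             =
    trans (W-J-symmetric n 0 k) (trans (J-cong (W≈profile n) k) (sym (profile-J n k)))

  W₀₀≈a : ∀ n → W n 0 0 ≈ a′ (2 ℕ.* n ℕ.+ 2) (+ 2)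
  W₀₀≈a n = trans (W≈profile n 0) (reflexive (≡.sym (≡.trans
    (≡.cong (λ m → a′ m (+ 2)) (≡.trans (ℕ.+-comm (2 ℕ.* n) 2) (≡.cong (2 ℕ.+_) (ℕ.*-comm 2 n))))
    (a-even n 0))))

-- Binomial coefficients with truncated subtraction, and halves of n.

-- For n < k the subtraction is truncated and all three binomials vanish.
pascal-∸ : ∀ n k → (suc n ∸ k) C suc k ≡ (n ∸ k) C suc k ℕ.+ (n ∸ k) C k
pascal-∸ n k with k ℕ.≤? n
... | yes k≤n = ≡.trans (≡.cong (_C suc k) (ℕ.+-∸-assoc 1 k≤n))
  (≡.trans (≡.sym (nCk+nC[k+1]≡[n+1]C[k+1] (n ∸ k) k)) (ℕ.+-comm ((n ∸ k) C k) _))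
... | no k≰n = ≡.trans (vanish (ℕ.≤-trans (ℕ.≤-reflexive (ℕ.m≤n⇒m∸n≡0 n<k)) ℕ.z≤n))
    (≡.sym (≡.cong₂ ℕ._+_ (vanish n∸k≤k) (k>n⇒nCk≡0 (≡.subst (ℕ._< k) (≡.sym n∸k≡0) 0<k))))
  where
  n<k = ℕ.≰⇒> k≰n
  0<k = ℕ.≤-<-trans ℕ.z≤n n<k
  n∸k≡0 = ℕ.m≤n⇒m∸n≡0 (ℕ.<⇒≤ n<k)
  n∸k≤k = ℕ.≤-trans (ℕ.≤-reflexive n∸k≡0) ℕ.z≤n
  vanish : ∀ {m} → m ℕ.≤ k → m C suc k ≡ 0
  vanish m≤k = k>n⇒nCk≡0 (ℕ.s≤s m≤k)

suc-C-2 : ∀ n → suc n C 2 ≡ n ℕ.+ n C 2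
suc-C-2 n = ≡.trans (≡.sym (nCk+nC[k+1]≡[n+1]C[k+1] n 1)) (≡.cong (ℕ._+ n C 2) (nC1≡n n))

⌊suc/2⌋ : ∀ n → ⌊ suc n /2⌋ ≡ suc ⌊ n /2⌋ ⊎ ⌊ suc n /2⌋ ≡ ⌊ n /2⌋
⌊suc/2⌋ zero          = inj₂ ≡.refl
⌊suc/2⌋ (suc zero)    = inj₁ ≡.refl
⌊suc/2⌋ (suc (suc n)) = Sum.map (≡.cong suc) (≡.cong suc) (⌊suc/2⌋ n)

n∸⌊n/2⌋≡⌈n/2⌉ : ∀ n → n ∸ ⌊ n /2⌋ ≡ ⌈ n /2⌉
n∸⌊n/2⌋≡⌈n/2⌉ n = ≡.trans
  (≡.cong (_∸ ⌊ n /2⌋) (≡.sym (ℕ.⌊n/2⌋+⌈n/2⌉≡n n))) (ℕ.m+n∸m≡n ⌊ n /2⌋ ⌈ n /2⌉)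

-- Closed form of the determinant of T.

module Evaluation {c ℓ} (R : CommutativeRing c ℓ) where
  open CommutativeRing R hiding (zero)

  -- Here u is t⁻¹, and ι is an additive embedding of the binomial coefficients, later the constant
  -- Laurent polynomials.
  module ClosedForm (t u : Carrier) (t*u≈1 : t * u ≈ 1#) (ι : ℕ → Carrier)
    (ι-0 : ι 0 ≈ 0#) (ι-1 : ι 1 ≈ 1#) (ι-+ : ∀ m n → ι (m ℕ.+ n) ≈ ι m + ι n) where

    open RawSemiringDefs (Semiring.rawSemiring semiring) using (_^_)
    open SemiringExp semiring using (^-homo-*)
    open SemiringSum semiring
      using (sum; sum-cong-≋; sum-cong-≗; *-distribˡ-sum; ∑-distrib-+; sum-init-last)
    open SemiringSolver commutativeSemiring using (solve; _:+_; _:*_; _:=_; con)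
    open SetoidReasoning setoid
    open Jacobi R t using (det-T; det-T-recurrence)

    summand : ℕ → ℕ → Carrier
    summand n k = (- 1#) ^ k * ι ((n ∸ k) C k) * u ^ k

    summand-zero : ∀ n → summand n 0 ≈ 1#
    summand-zero n = trans (*-congʳ (*-congˡ ι-1)) (solve 0 (con 1 :* con 1 :* con 1 := con 1) refl)

    summand-pascal : ∀ n k → summand (2 ℕ.+ n) (suc k) ≈ summand (suc n) (suc k) + - 1# * u * summand n k
    summand-pascal n k = begin
      - 1# * (- 1#) ^ k * ι ((suc n ∸ k) C suc k) * (u * u ^ k)
        ≈⟨ *-congʳ (*-congˡ (trans (reflexive (≡.cong ι (pascal-∸ n k))) (ι-+ _ _))) ⟩
      - 1# * (- 1#) ^ k * (ι ((n ∸ k) C suc k) + ι ((n ∸ k) C k)) * (u * u ^ k)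
        ≈⟨ solve 6 (λ m s x y u v → m :* s :* (x :+ y) :* (u :* v) :=
                      m :* s :* x :* (u :* v) :+ m :* u :* (s :* y :* v))
             refl (- 1#) ((- 1#) ^ k) (ι ((n ∸ k) C suc k)) (ι ((n ∸ k) C k)) u (u ^ k) ⟩
      summand (suc n) (suc k) + - 1# * u * summand n k ∎

    -- The length N is kept apart from n, since Pascal's rule relates sums whose natural lengths
    -- differ.
    partial : ℕ → ℕ → Carrier
    partial N n = sum λ (k : Fin N) → summand n (toℕ k)

    partial-pascal : ∀ N n → partial (suc N) (2 ℕ.+ n) ≈ partial (suc N) (suc n) + - 1# * u * partial N n
    partial-pascal N n = begin
      summand (2 ℕ.+ n) 0 + sum (λ (k : Fin N) → summand (2 ℕ.+ n) (suc (toℕ k)))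
        ≈⟨ +-cong (trans (summand-zero (2 ℕ.+ n)) (sym (summand-zero (suc n)))) (trans
             (sum-cong-≋ {N} (summand-pascal n ∘ toℕ))
             (∑-distrib-+ {N} (λ k → summand (suc n) (suc (toℕ k))) (λ k → - 1# * u * summand n (toℕ k)))) ⟩
      summand (suc n) 0 +
        (sum (λ (k : Fin N) → summand (suc n) (suc (toℕ k))) + sum (λ (k : Fin N) → - 1# * u * summand n (toℕ k)))
        ≈⟨ +-assoc _ _ _ ⟨
      partial (suc N) (suc n) + sum (λ (k : Fin N) → - 1# * u * summand n (toℕ k))
        ≈⟨ +-congˡ (*-distribˡ-sum {N} (- 1# * u) (summand n ∘ toℕ)) ⟨
      partial (suc N) (suc n) + - 1# * u * partial N n ∎

    partial-suc : ∀ N n → partial (suc N) n ≈ partial N n + summand n N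
    partial-suc N n = trans (sum-init-last {N} (summand n ∘ toℕ)) (reflexive (≡.cong₂ _+_
      (sum-cong-≗ {N} (≡.cong (summand n) ∘ Fin.toℕ-inject₁))
      (≡.cong (summand n) (Fin.toℕ-fromℕ N))))

    S : ℕ → Carrier
    S n = partial (suc ⌊ n /2⌋) n

    -- Pascal's rule produces ⌊n/2⌋ + 2 terms at n + 1. This is the length of `S (suc n)` or one
    -- more, and in the latter case the last binomial vanishes.
    S-extend : ∀ n → partial (2 ℕ.+ ⌊ n /2⌋) (suc n) ≈ S (suc n)
    S-extend n with ⌊suc/2⌋ n
    ... | inj₁ eq = reflexive (≡.cong (λ N → partial (suc N) (suc n)) (≡.sym eq))
    ... | inj₂ eq = begin
      partial (2 ℕ.+ ⌊ n /2⌋) (suc n)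
        ≈⟨ partial-suc (suc ⌊ n /2⌋) (suc n) ⟩
      partial (suc ⌊ n /2⌋) (suc n) + summand (suc n) (suc ⌊ n /2⌋)
        ≈⟨ +-cong (reflexive (≡.cong (λ N → partial (suc N) (suc n)) (≡.sym eq))) summand≈0 ⟩
      S (suc n) + 0#
        ≈⟨ +-identityʳ _ ⟩
      S (suc n) ∎
      where
      C≡0 : (n ∸ ⌊ n /2⌋) C suc ⌊ n /2⌋ ≡ 0
      -- ⌈n/2⌉ is ⌊(n+1)/2⌋ by definition, so `eq` puts the upper index just below the lower one.
      C≡0 = k>n⇒nCk≡0 (ℕ.s≤s (ℕ.≤-reflexive (≡.trans (n∸⌊n/2⌋≡⌈n/2⌉ n) eq)))

      summand≈0 : summand (suc n) (suc ⌊ n /2⌋) ≈ 0#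
      summand≈0 = trans
        (*-congʳ (trans (*-congˡ (trans (reflexive (≡.cong ι C≡0)) ι-0)) (zeroʳ _)))
        (zeroˡ _)

    S-recurrence : ∀ n → S (2 ℕ.+ n) ≈ S (suc n) + - 1# * u * S n
    S-recurrence n = trans (partial-pascal (suc ⌊ n /2⌋) n) (+-congʳ (S-extend n))

    t^-C-2 : ∀ n → t ^ (suc n C 2) ≈ t ^ n * t ^ (n C 2)
    t^-C-2 n = trans (reflexive (≡.cong (t ^_) (suc-C-2 n))) (^-homo-* t n (n C 2))

    det-T-closed : ∀ n → det-T n ≈ t ^ (n C 2) * S n
    det-T-closed zero          = sym (trans (*-congˡ (+-congʳ (summand-zero 0)))
      (solve 0 (con 1 :* (con 1 :+ con 0) := con 1) refl))
    det-T-closed (suc zero)    = sym (trans (*-congˡ (+-congʳ (summand-zero 1)))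
      (solve 0 (con 1 :* (con 1 :+ con 0) := con 1 :* (con 1 :* con 1) :+ con 0) refl))
    det-T-closed (suc (suc n)) = begin
      det-T (2 ℕ.+ n)
        ≈⟨ det-T-recurrence n ⟩
      t ^ suc n * det-T (suc n) + - 1# * (t ^ n * t ^ n * det-T n)
        ≈⟨ +-cong (*-congˡ (det-T-closed (suc n))) (*-congˡ (*-congˡ (det-T-closed n))) ⟩
      p * (t ^ (suc n C 2) * S (suc n)) + - 1# * (q * q * (r * S n))
        -- The power of t in the second term has exponent 2n + C(n,2), one less than C(n+2,2). The
        -- inserted 1 becomes t * u: t supplies the missing factor and u is the one in
        -- `S-recurrence`.
        ≈⟨ +-cong (sym (*-assoc p _ _)) (sym (*-identityˡ _)) ⟩
      p * t ^ (suc n C 2) * S (suc n) + 1# * (- 1# * (q * q * (r * S n)))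
        ≈⟨ +-cong (*-congʳ (*-congˡ (t^-C-2 n))) (*-congʳ (sym t*u≈1)) ⟩
      p * (q * r) * S (suc n) + t * u * (- 1# * (q * q * (r * S n)))
        ≈⟨ solve 7 (λ t u q r x y m →
             (t :* q) :* (q :* r) :* x :+ t :* u :* (m :* (q :* q :* (r :* y))) :=
             (t :* q) :* (q :* r) :* (x :+ m :* u :* y))
             refl t u q r (S (suc n)) (S n) (- 1#) ⟩
      p * (q * r) * (S (suc n) + - 1# * u * S n)
        ≈⟨ *-cong (trans (*-congˡ (sym (t^-C-2 n))) (sym (t^-C-2 (suc n)))) (sym (S-recurrence n)) ⟩
      t ^ ((2 ℕ.+ n) C 2) * S (2 ℕ.+ n) ∎
      where
      p q r : Carrier
      p = t ^ suc n
      q = t ^ n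
      r = t ^ (n C 2)

-- Specialisation to Laurent polynomials in t.

theorem5p2 : (n : ℕ) → let open LaurentOps in
    det ℤ[t,t⁻¹] (λ (i j : Fin n) → C⁽³⁾ (toℕ i ℕ.+ toℕ j))
    ≈ t^ (+ (n C 2)) * sum (λ (k : Fin (suc ⌊ n /2⌋)) → (- 1#) ^ toℕ k * const (+ ((n ∸ toℕ k) C toℕ k)) * t^ (ℤ.- (+ toℕ k)))
theorem5p2 n = begin
  det ℤ[t,t⁻¹] (λ (i j : Fin n) → C⁽³⁾ (toℕ i ℕ.+ toℕ j))
    ≈⟨ det-cong {n} (λ i j → sym {W (toℕ i ℕ.+ toℕ j) 0 0} {C⁽³⁾ (toℕ i ℕ.+ toℕ j)}
         (W₀₀≈a (toℕ i ℕ.+ toℕ j))) ⟩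
  det ℤ[t,t⁻¹] (λ (i j : Fin n) → W (toℕ i ℕ.+ toℕ j) 0 0)
    ≈⟨ det-hankel n ⟩
  det-T n
    ≈⟨ det-T-closed n ⟩
  (t^ 1ℤ) ^ (n C 2) * S n
    -- Iterated products of t and t⁻¹ are replaced by single monomials with integer exponents.
    ≈⟨ *-cong {(t^ 1ℤ) ^ (n C 2)} {t^ (+ (n C 2))} {S n} {sum s}
         (t^-^≈t^ 1ℤ (n C 2) (+ (n C 2)) (ℤ.*-identityʳ (+ (n C 2))))
         (sum-cong-≋ {suc ⌊ n /2⌋} {λ k → summand n (toℕ k)} {s} summand≈) ⟩
  t^ (+ (n C 2)) * sum (λ (k : Fin (suc ⌊ n /2⌋)) → (- 1#) ^ toℕ k * const (+ ((n ∸ toℕ k) C toℕ k)) * t^ (ℤ.- (+ toℕ k))) ∎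
  where
  open CommutativeRing LaurentRing.commutativeRing
  open LaurentOps using (_^_; sum)
  open SetoidReasoning setoid
  open SemiringSum semiring using (sum-cong-≋)
  open Determinant LaurentRing.commutativeRing using (det-cong)
  open Jacobi LaurentRing.commutativeRing (t^ 1ℤ) using (W; W₀₀≈a; det-hankel; det-T)
  open Evaluation.ClosedForm LaurentRing.commutativeRing (t^ 1ℤ) (t^ -1ℤ) (λ _ → ≡.refl)
    (λ m → const (+ m)) LaurentRing.const-0 (λ _ → ≡.refl) (λ m n → LaurentRing.const-+ (+ m) (+ n))
    using (summand; S; det-T-closed)

  t^-^≈t^ : ∀ e m i → + m ℤ.* e ≡ i → (t^ e) ^ m ≈ t^ i
  t^-^≈t^ e m _ ≡.refl = LaurentRing.t^-^ e m

  s : Fin (suc ⌊ n /2⌋) → Laurent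
  s k = (- 1#) ^ toℕ k * const (+ ((n ∸ toℕ k) C toℕ k)) * t^ (ℤ.- (+ toℕ k))

  summand≈ : ∀ k → summand n (toℕ k) ≈ s k
  summand≈ k = *-congˡ {(- 1#) ^ toℕ k * const (+ ((n ∸ toℕ k) C toℕ k))}
    {(t^ -1ℤ) ^ toℕ k} {t^ (ℤ.- (+ toℕ k))}
    (t^-^≈t^ -1ℤ (toℕ k) (ℤ.- (+ toℕ k)) (≡.trans (ℤ.*-comm (+ toℕ k) -1ℤ) (ℤ.-1*i≡-i (+ toℕ k))))
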